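{- Let $G=(V,E)$ be a graph, let $f\colon V\to\{0,1,2\}$ be a function, and put $G'=G[V_0(f)\cup V_2(f)]$. Then $f$ is a minimal Roman dominating function of $G$ if and only if the following three conditions hold: 1. $N_G[V_2(f)]\cap V_1(f)=\emptyset$; 2. for all $v\in V_2(f)$: $P_{G',V_2(f)}(v)\nsubseteq\{v\}$; 3. $V_2(f)$ is a minimal dominating set of $G'$.
   Context: Graphs are finite, undirected and simple. For a graph $G=(V,E)$: $N_G(v)$ is the open neighborhood of $v$, $N_G[v]=N_G(v)\cup\{v\}$ the closed neighborhood, $N_G[U]=\bigcup_{u\in U}N_G[u]$ for $U\subseteq V$; $G[U]$ is the subgraph induced by $U$. A set $D\subseteq V$ is a dominating set of $G$ if $N_G[D]=V$; minimal means inclusion-minimal. For $D\subseteq V$ and $v\in D$, the private neighborhood is $P_{G,D}(v)=N_G[v]\setminus N_G[D\setminus\{v\}]$. For $f\colon V\to\{0,1,2\}$ let $V_i(f)=\{v\in V\mid f(v)=i\}$. The function $f$ is a Roman dominating function (rdf) if every $v$ with $f(v)=0$ has a neighbor $u\in N_G(v)$ with $f(u)=2$. For $f,g\in\{0,1,2\}^V$, $f\le g$ means $f(v)\le g(v)$ for all $v\in V$ (with $0<1<2$). An rdf $f$ is minimal if there is no rdf $g\neq f$ with $g\le f$. -}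

module Defs where

open import Data.Fin.Base using (Fin; _≤_)
open import Data.Fin.Patterns using (0F; 1F; 2F)
open import Data.Product.Base using (_×_; ∃-syntax)
open import Data.Refinement using (Refinement; value)
open import Level using (0ℓ)
open import Relation.Binary.Core using (Rel)
open import Relation.Binary.Definitions using (Decidable; Irreflexive; Symmetric)
open import Relation.Binary.PropositionalEquality using (_≡_; _≗_; cong)
open import Relation.Nullary.Negation using (¬_)
open import Relation.Unary
  using (Pred; _∈_; _⊂_; _∪_; _∖_; _⊢_; ｛_｝; Universal)

-- The vertex type is arbitrary; finiteness is a separate hypothesis on it.
record SimpleGraph (V : Set) : Set₁ where
  infix 4 _~_ _~?_
  field
    _~_    : Rel V 0ℓ
    _~?_   : Decidable _~_
    symm   : Symmetric _~_
    irrefl : Irreflexive _≡_ _~_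

-- The vertices of G[U] are those of U. `Refinement` makes the membership
-- proof irrelevant, so each element of U gives exactly one vertex.
induced : {V : Set} → SimpleGraph V → (U : Pred V 0ℓ) → SimpleGraph (Refinement V U)
induced G U = record
  { _~_    = λ x y → value x ~ value y
  ; _~?_   = λ x y → value x ~? value y
  ; symm   = symm
  ; irrefl = λ x≡y → irrefl (cong value x≡y)
  }
  where open SimpleGraph G

-- A subset S of V, regarded as a subset of the vertices of an induced
-- subgraph G[U]; used for S ⊆ U.
restrict : {V : Set} (U : Pred V 0ℓ) → Pred V 0ℓ → Pred (Refinement V U) 0ℓ
restrict U S = value ⊢ S

module _ {V : Set} (G : SimpleGraph V) where
  open SimpleGraph G

  N⟨_⟩ : V → Pred V 0ℓ
  N⟨ v ⟩ = λ u → v ~ u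

  N[_] : V → Pred V 0ℓ
  N[ v ] = N⟨ v ⟩ ∪ ｛ v ｝

  N[_]ˢ : Pred V 0ℓ → Pred V 0ℓ
  N[ S ]ˢ = λ w → ∃[ u ] u ∈ S × w ∈ N[ u ]

  Dominating : Pred V 0ℓ → Set
  Dominating D = Universal N[ D ]ˢ

  MinimalDominating : Pred V 0ℓ → Set₁
  MinimalDominating D =
    Dominating D × ¬ (∃[ D′ ] D′ ⊂ D × Dominating D′)

  PrivateNbhd : Pred V 0ℓ → V → Pred V 0ℓ
  PrivateNbhd D v = N[ v ] ∖ N[ D ∖ ｛ v ｝ ]ˢ

Labelling : Set → Set
Labelling V = V → Fin 3

module _ {V : Set} where

  level : Fin 3 → Labelling V → Pred V 0ℓ
  level i f = λ v → f v ≡ i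

  infix 4 _≤ˡ_
  _≤ˡ_ : Rel (Labelling V) 0ℓ
  f ≤ˡ g = ∀ v → f v ≤ g v

  V₀ V₁ V₂ : Labelling V → Pred V 0ℓ
  V₀ = level 0F
  V₁ = level 1F
  V₂ = level 2F

module _ {V : Set} (G : SimpleGraph V) where

  RomanDominating : Labelling V → Set
  RomanDominating f = ∀ v → f v ≡ 0F → ∃[ u ] u ∈ N⟨_⟩ G v × f u ≡ 2F

  -- Distinctness of labellings is extensional.
  MinimalRomanDominating : Labelling V → Set
  MinimalRomanDominating f =
    RomanDominating f × ¬ (∃[ g ] RomanDominating g × ¬ (g ≗ f) × g ≤ˡ f)

{-# OPTIONS --safe #-}
-- Lowering a single label tests minimality: lowering 1 to 0 at w keeps f Roman
-- dominating if w has a neighbour in V₂, and lowering 2 to 1 at v keeps it so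
-- if every w ∈ V₀ has a neighbour in V₂ ∖ {v}, i.e. if v has no private
-- neighbour in G′ other than itself.  Conversely, a vertex of V₀ that is a
-- private neighbour of v forces the label 2 at v in every Roman dominating
-- g ≤ f.  Moreover any private neighbour of v forces v into every dominating
-- subset of V₂, so minimality in (3) follows from (2).
module Submission where

open import Defs
open import Data.Fin.Base using (Fin; _≤_; _<_)
open import Data.Fin.Patterns using (0F; 1F; 2F)
open import Data.Fin.Properties as Fin using (<⇒≢; ≤-antisym; ≤-refl)
open import Data.Irrelevant using ([_])
open import Data.Nat.Base using (ℕ; z≤n; z<s; s<s)
open import Data.Nat.Properties using (<⇒≤)
open import Data.Product.Base using (_×_; ∃; ∃-syntax; _,_; proj₁; proj₂)
open import Data.Refinement as Ref using (Refinement; value; _,_; value-injective)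
open import Data.Sum.Base using (inj₁; inj₂)
open import Function.Base using (_∘_)
open import Function.Bundles using (_⇔_; _↔_; mk⇔; module Inverse)
open import Function.Properties.Inverse using (↔⇒↣)
open import Level using (0ℓ)
open import Relation.Binary.Definitions using (DecidableEquality)
open import Relation.Binary.PropositionalEquality
  using (_≡_; _≢_; _≗_; refl; sym; trans; cong; subst)
open import Relation.Nullary.Decidable
  using (Dec; yes; no; map′; recompute; decidable-stable; via-injection; ¬?; _×-dec_)
open import Relation.Nullary.Negation using (¬_; contradiction)
open import Relation.Unary
  using (Pred; Decidable; _∈_; _∩_; _∪_; _⊆_; _⊈_; Empty; ｛_｝)
open import Relation.Unary.Properties using (_∪?_)

-- Apart from decidable equality, this is the form in which finiteness is used. It passes from `V`
-- to `Refinement V U` directly, without enumerating the subtype.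
Searchable : Set → Set₁
Searchable A = {P : Pred A 0ℓ} → Decidable P → Dec (∃ P)

↔Fin⇒searchable : {V : Set} {n : ℕ} → V ↔ Fin n → Searchable V
↔Fin⇒searchable V↔Fin {P} P? = map′
  (λ (i , p) → from i , p)
  (λ (v , p) → to v , subst P (sym (strictlyInverseʳ v)) p)
  (Fin.any? (P? ∘ from))
  where open Inverse V↔Fin

refinement-searchable : {V : Set} {U : Pred V 0ℓ} →
  Searchable V → Decidable U → Searchable (Refinement V U)
refinement-searchable {V} {U} search U? {P} P? = map′
  (λ (v , u , p) → (v , [ u ]) , p)
  (λ { ((v , [ u ]) , p) → v , recompute (U? v) u , p })
  (search Q?)
  where
  Q? : Decidable (λ v → ∃[ u ] P (v , [ u ]))
  Q? v with U? v
  ... | no ¬u = no (¬u ∘ proj₁)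
  -- By irrelevance, `P (v , [ u ])` is the same type for every proof `u`, so testing one proof
  -- suffices.
  ... | yes u = map′ (u ,_) proj₂ (P? (v , [ u ]))

module _ {V : Set} (_≟_ : DecidableEquality V) (search : Searchable V)
         (G : SimpleGraph V) where

  -- `dom` chooses a dominator in `D′` for each vertex. If `v` is never chosen, every choice lies in
  -- `D` without `v`, and no vertex is private to `v`. Searching for a vertex where `v` is chosen
  -- turns the doubly negated hypothesis into actual membership.
  private⇒∈ : {D D′ : Pred V 0ℓ} {v : V} →
    D′ ⊆ D → Dominating G D′ → ¬ Empty (PrivateNbhd G D v) → v ∈ D′
  private⇒∈ {D} {D′} {v} D′⊆D dom nonempty
    with search (λ w → v ≟ proj₁ (dom w))
  ... | yes (w , refl) = proj₁ (proj₂ (dom w))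
  ... | no unused = contradiction empty nonempty
    where
    empty : Empty (PrivateNbhd G D v)
    empty w (_ , notElsewhere) =
      let u , u∈D′ , w∈N[u] = dom w
      in notElsewhere (u , (D′⊆D u∈D′ , λ v≡u → unused (w , v≡u)) , w∈N[u])

  private⇒minimalDominating : {D : Pred V 0ℓ} → Dominating G D →
    (∀ v → v ∈ D → ¬ Empty (PrivateNbhd G D v)) → MinimalDominating G D
  private⇒minimalDominating {D} dom nonempty =
    dom , λ (D′ , (D′⊆D , D⊈D′) , dom′) →
      D⊈D′ λ {v} v∈D → private⇒∈ D′⊆D dom′ (nonempty v v∈D)

module _ {V : Set} (_≟_ : DecidableEquality V) where

  relabel : Labelling V → V → Fin 3 → Labelling V
  relabel f w i v with w ≟ v
  ... | yes _ = i
  ... | no  _ = f v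

  relabel-updates : ∀ f w i → relabel f w i w ≡ i
  relabel-updates f w i with w ≟ w
  ... | yes _  = refl
  ... | no w≢w = contradiction refl w≢w

  relabel-minimal : ∀ f w i {v} → w ≢ v → relabel f w i v ≡ f v
  relabel-minimal f w i {v} w≢v with w ≟ v
  ... | yes w≡v = contradiction w≡v w≢v
  ... | no _    = refl

  relabel-≤ : ∀ f w {i} → i ≤ f w → relabel f w i ≤ˡ f
  relabel-≤ f w i≤fw v with w ≟ v
  ... | yes refl = i≤fw
  ... | no _     = ≤-refl

  lowered-not-roman : ∀ {G f w i} → MinimalRomanDominating G f →
    i < f w → ¬ RomanDominating G (relabel f w i)
  lowered-not-roman {f = f} {w} {i} (_ , minimal) i<fw roman = minimal
    ( relabel f w i
    , roman
    , (λ same → <⇒≢ i<fw (trans (sym (relabel-updates f w i)) (same w)))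
    , relabel-≤ f w (<⇒≤ i<fw) )

module Characterization {V : Set} (_≟_ : DecidableEquality V) (search : Searchable V)
                        (G : SimpleGraph V) (f : Labelling V) where
  open SimpleGraph G

  U : Pred V 0ℓ
  U = V₀ f ∪ V₂ f

  G′ : SimpleGraph (Refinement V U)
  G′ = induced G U

  D : Pred (Refinement V U) 0ℓ
  D = restrict U (V₂ f)

  V₁-Isolated HasExternalPrivate : Set
  V₁-Isolated = Empty (N[_]ˢ G (V₂ f) ∩ V₁ f)
  HasExternalPrivate = ∀ v → v ∈ D → PrivateNbhd G′ D v ⊈ ｛ v ｝

  U? : Decidable U
  U? = (λ v → f v Fin.≟ 0F) ∪? (λ v → f v Fin.≟ 2F)

  -- Membership in U is irrelevant in a vertex of G′, hence the recomputation.
  vertex-in-U : (x : Refinement V U) → value x ∈ U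
  vertex-in-U (v , [ v∈U ]) = recompute (U? v) v∈U

  label-clash : ∀ {i j : Fin 3} {v} → f v ≡ i → f v ≡ j → i ≢ j → {A : Set} → A
  label-clash fv≡i fv≡j i≢j = contradiction (trans (sym fv≡i) fv≡j) i≢j

  minimal⇒V₁-isolated : MinimalRomanDominating G f → V₁-Isolated
  minimal⇒V₁-isolated _ w ((u , fu≡2 , inj₂ refl) , fw≡1) =
    label-clash fu≡2 fw≡1 λ ()
  minimal⇒V₁-isolated min@(roman , _) w ((u , fu≡2 , inj₁ u~w) , fw≡1) =
    lowered-not-roman _≟_ {G} min (subst (_<_ {3} 0F) (sym fw≡1) z<s) lowered-roman
    where
    g : Labelling V
    g = relabel _≟_ f w 0F

    -- The lowered vertex had label 1, so no label 2 is lost.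
    g≡2 : ∀ {x} → f x ≡ 2F → g x ≡ 2F
    g≡2 fx≡2 =
      trans (relabel-minimal _≟_ f w 0F λ { refl → label-clash fx≡2 fw≡1 λ () }) fx≡2

    lowered-roman : RomanDominating G g
    lowered-roman v gv≡0 with w ≟ v
    ... | yes refl = u , symm u~w , g≡2 fu≡2
    ... | no w≢v   = let x , v~x , fx≡2 = roman v gv≡0 in x , v~x , g≡2 fx≡2

  minimal⇒hasExternalPrivate : MinimalRomanDominating G f → HasExternalPrivate
  minimal⇒hasExternalPrivate min@(roman , _) v fv≡2 P⊆v =
    lowered-not-roman _≟_ {G} min (subst (_<_ {3} 1F) (sym fv≡2) (s<s z<s)) lowered-roman
    where
    g : Labelling V
    g = relabel _≟_ f (value v) 1F

    -- If the search fails, the neighbour supplied by `roman` is `v` itself and `w` is private to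
    -- `v` in `G′`. Then `P⊆v` identifies `w` with `v`, although their labels are 0 and 2.
    other-neighbour : ∀ w → f w ≡ 0F → ∃[ u ] w ~ u × f u ≡ 2F × value v ≢ u
    other-neighbour w fw≡0
      with search (λ u → (w ~? u) ×-dec (f u Fin.≟ 2F) ×-dec ¬? (value v ≟ u))
         | roman w fw≡0
    ... | yes found | _ = found
    ... | no none | u , w~u , fu≡2 with value v ≟ u
    ...   | no v≢u   = contradiction (u , w~u , fu≡2 , v≢u) none
    ...   | yes refl = label-clash fv≡2 (trans (cong f (cong value v≡w)) fw≡0) λ ()
      where
      v≡w : v ≡ (w , [ inj₁ fw≡0 ])
      v≡w = P⊆v (inj₁ (symm w~u) , λ
        { (x , (fx≡2 , v≢x) , inj₁ x~w) →
            none (value x , symm x~w , fx≡2 , λ v≡x → v≢x (value-injective v≡x))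
        ; (x , (fx≡2 , _) , inj₂ refl) → label-clash fx≡2 fw≡0 λ () })

    lowered-roman : RomanDominating G g
    lowered-roman w gw≡0 with value v ≟ w
    lowered-roman w () | yes _
    lowered-roman w gw≡0 | no _ =
      let u , w~u , fu≡2 , v≢u = other-neighbour w gw≡0
      in u , w~u , trans (relabel-minimal _≟_ f (value v) 1F v≢u) fu≡2

  -- Vertices labelled 2 dominate themselves, and for those labelled 0 domination by `D` is the
  -- Roman condition. Label 1 demands nothing, and its vertices are absent from `G′`.
  roman⇒dominating : RomanDominating G f → Dominating G′ D
  roman⇒dominating roman x with vertex-in-U x
  ... | inj₂ fx≡2 = x , fx≡2 , inj₂ refl
  ... | inj₁ fx≡0 =
    let u , x~u , fu≡2 = roman (value x) fx≡0
    in (u , [ inj₂ fu≡2 ]) , fu≡2 , inj₁ (symm x~u)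

  dominating⇒roman : Dominating G′ D → RomanDominating G f
  dominating⇒roman dom v fv≡0 with dom (v , [ inj₁ fv≡0 ])
  ... | u , fu≡2 , inj₁ u~v  = value u , symm u~v , fu≡2
  ... | u , fu≡2 , inj₂ refl = label-clash fu≡2 fv≡0 λ ()

  hasExternalPrivate⇒minimalDominating :
    HasExternalPrivate → Dominating G′ D → MinimalDominating G′ D
  hasExternalPrivate⇒minimalDominating external dom =
    private⇒minimalDominating (Ref._≟_ _≟_) (refinement-searchable search U?) G′ dom
      -- An empty private neighbourhood would lie in `｛ v ｝` vacuously.
      λ v v∈D empty → external v v∈D λ {w} w∈P → contradiction w∈P (empty w)

  module _ (isolated : V₁-Isolated) (external : HasExternalPrivate)
           (g : Labelling V) (roman : RomanDominating G g) (g≤f : g ≤ˡ f) where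

    V₂-mono : ∀ {v} → g v ≡ 2F → f v ≡ 2F
    V₂-mono {v} gv≡2 = ≤-antisym (Fin.≤fromℕ (f v)) (subst (_≤ f v) gv≡2 (g≤f v))

    V₀-anti : ∀ {v} → f v ≡ 0F → g v ≡ 0F
    V₀-anti {v} fv≡0 = ≤-antisym (subst (g v ≤_) fv≡0 (g≤f v)) z≤n

    -- A drop to 0 would require a neighbour labelled 2 by `g`, hence by `f`, against `isolated`.
    V₁-preserved : ∀ {v} → f v ≡ 1F → g v ≡ 1F
    V₁-preserved {v} fv≡1 with g v in gv≡i | subst (g v ≤_) fv≡1 (g≤f v)
    ... | 1F | _ = refl
    ... | 2F | _ = label-clash fv≡1 (V₂-mono gv≡i) λ ()
    ... | 0F | _ =
      let u , v~u , gu≡2 = roman v gv≡i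
      in contradiction ((u , V₂-mono gu≡2 , inj₁ (symm v~u)) , fv≡1) (isolated v)

    -- `external` is a negated inclusion and exhibits no private neighbour. Instead, `g v ≢ 2F` is
    -- assumed and every private neighbour is shown equal to `v`; decidable equality removes the
    -- double negations.
    V₂-preserved : ∀ {v} → f v ≡ 2F → g v ≡ 2F
    V₂-preserved {v} fv≡2 = decidable-stable (g v Fin.≟ 2F) λ gv≢2 →
      external v′ fv≡2 λ {w} w∈P → decidable-stable (Ref._≟_ _≟_ v′ w) λ v≢w →
        no-external gv≢2 w w∈P v≢w
      where
      v′ : Refinement V U
      v′ = v , [ inj₂ fv≡2 ]

      no-external : g v ≢ 2F → ∀ w → w ∈ PrivateNbhd G′ D v′ → ¬ (v′ ≢ w)
      no-external gv≢2 w (_ , notElsewhere) v≢w with vertex-in-U w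
      ... | inj₂ fw≡2 = notElsewhere (w , (fw≡2 , v≢w) , inj₂ refl)
      -- `g` must cover `w` by a vertex it labels 2. This is not `v`, so `w` has a neighbour in `D`
      -- other than `v` and is not private.
      ... | inj₁ fw≡0 =
        let u , w~u , gu≡2 = roman (value w) (V₀-anti fw≡0)
            fu≡2 = V₂-mono gu≡2
            v≢u = λ v≡u → gv≢2 (trans (cong (g ∘ value) v≡u) gu≡2)
        in notElsewhere ((u , [ inj₂ fu≡2 ]) , (fu≡2 , v≢u) , inj₁ (symm w~u))

    unchanged : g ≗ f
    unchanged v with f v in fv≡i
    ... | 0F = V₀-anti fv≡i
    ... | 1F = V₁-preserved fv≡i
    ... | 2F = V₂-preserved fv≡i

  characterization : MinimalRomanDominating G f ⇔
    (V₁-Isolated × HasExternalPrivate × MinimalDominating G′ D)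
  characterization = mk⇔
    (λ min →
      let external = minimal⇒hasExternalPrivate min
      in minimal⇒V₁-isolated min
       , external
       , hasExternalPrivate⇒minimalDominating external (roman⇒dominating (proj₁ min)))
    (λ (isolated , external , dom , _) →
      dominating⇒roman dom
      , λ (g , roman , g≢f , g≤f) → g≢f (unchanged isolated external g roman g≤f))

theorem3 : {V : Set} {n : ℕ} → V ↔ Fin n →
    (G : SimpleGraph V) (f : Labelling V) →
    let U = V₀ f ∪ V₂ f
        G′ = induced G U
        D = restrict U (V₂ f)
    in MinimalRomanDominating G f ⇔
       ( Empty (N[_]ˢ G (V₂ f) ∩ V₁ f)
       × (∀ (v : Refinement V U) → v ∈ D → PrivateNbhd G′ D v ⊈ ｛ v ｝)
       × MinimalDominating G′ D )
theorem3 V↔Fin = Characterization.characterization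
  (via-injection (↔⇒↣ V↔Fin) Fin._≟_) (↔Fin⇒searchable V↔Fin)
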